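{- There are no vertex-critical graphs in $\mathcal{H}$; that is, for every positive integer $k$, no graph in the class $\mathcal{H}$ is $k$-vertex-critical.
   Context: All graphs are finite and simple. $\chi(G)$ denotes the chromatic number. A graph $G$ is $k$-vertex-critical if $\chi(G)=k$ and $\chi(G-v)<k$ for all $v\in V(G)$. $P_n$ is the path on $n$ vertices; the gem is $P_4$ plus a vertex adjacent to all four of its vertices. A graph is $(P_5,\text{gem})$-free if it contains neither $P_5$ nor the gem as an induced subgraph. For $S,T\subseteq V(G)$, $S$ is complete (anti-complete) to $T$ if every $s\in S$ is adjacent (non-adjacent) to every $t\in T$. A module of $G$ is a set $S\subseteq V(G)$ such that every vertex of $V(G)\setminus S$ is either complete or anti-complete to $S$. $\mathcal{H}$ is the class of $(P_5,\text{gem})$-free graphs $G$ such that $V(G)$ can be partitioned into seven non-empty sets $A_1,\ldots,A_7$ such that: (1) $A_1$ is complete to $A_2\cup A_5\cup A_6$ and anti-complete to $A_3\cup A_4\cup A_7$; (2) $A_2$ is complete to $A_1\cup A_3$ and anti-complete to $A_4\cup A_5\cup A_6\cup A_7$; (3) $A_3$ is complete to $A_2\cup A_4\cup A_6$ and anti-complete to $A_1\cup A_5\cup A_7$; (4) $A_4$ is complete to $A_3\cup A_5\cup A_6$ and anti-complete to $A_1\cup A_2\cup A_7$; (5) $A_5$ is complete to $A_1\cup A_4$ and anti-complete to $A_2\cup A_3\cup A_6\cup A_7$; (6) the vertex set of every component of $G[A_7]$ is a module of $G$; (7) every vertex in $A_7$ has a neighbour in $A_6$. -}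

module Defs where

open import Data.Empty using (⊥)
open import Data.Fin using (Fin; zero; suc; toℕ; punchIn; #_)
open import Data.Nat using (ℕ; zero; suc; pred; _≤_; _<_)
import Data.Nat.Properties as ℕ
open import Data.Product using (∃; _×_)
open import Data.Sum using (_⊎_; inj₁; inj₂; swap)
open import Data.Unit using (⊤; tt)
open import Function.Bundles using (_⇔_)
open import Function.Definitions using (Injective)
open import Level using (0ℓ)
open import Relation.Binary using (Rel; Decidable; Symmetric; Irreflexive)
open import Relation.Binary.Construct.Closure.ReflexiveTransitive using (Star)
open import Relation.Binary.PropositionalEquality using (_≡_; _≢_; refl; sym; cong)
open import Relation.Nullary using (¬_; yes; no)
open import Relation.Nullary.Decidable using (_⊎-dec_)
open import Relation.Unary using (Pred; _∈_; _∉_; _∪_; ｛_｝)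

private
  variable
    m n : ℕ

-- A finite simple graph with vertex set Fin n.
record Graph (n : ℕ) : Set₁ where
  field
    Adj    : Rel (Fin n) 0ℓ
    adj?   : Decidable Adj
    symm   : Symmetric Adj
    irrefl : Irreflexive _≡_ Adj

open Graph public

VSet : ℕ → Set₁
VSet n = Pred (Fin n) 0ℓ

path : (n : ℕ) → Graph n
path n = record
  { Adj    = λ i j → (toℕ j ≡ suc (toℕ i)) ⊎ (toℕ i ≡ suc (toℕ j))
  ; adj?   = λ i j → (toℕ j ℕ.≟ suc (toℕ i)) ⊎-dec (toℕ i ℕ.≟ suc (toℕ j))
  ; symm   = swap
  ; irrefl = λ { refl (inj₁ p) → ℕ.1+n≢n (sym p)
               ; refl (inj₂ p) → ℕ.1+n≢n (sym p) }
  }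

-- H together with one new vertex, zero, adjacent to every vertex of H.
cone : Graph n → Graph (suc n)
cone {n} H = record { Adj = C ; adj? = C? ; symm = λ {i} {j} → C-sym i j ; irrefl = C-irr }
  where
  C : Rel (Fin (suc n)) 0ℓ
  C zero    zero    = ⊥
  C zero    (suc _) = ⊤
  C (suc _) zero    = ⊤
  C (suc i) (suc j) = Adj H i j

  C? : Decidable C
  C? zero    zero    = no (λ ())
  C? zero    (suc _) = yes tt
  C? (suc _) zero    = yes tt
  C? (suc i) (suc j) = adj? H i j

  C-sym : ∀ i j → C i j → C j i
  C-sym zero    (suc _) _ = tt
  C-sym (suc _) zero    _ = tt
  C-sym (suc _) (suc _) e = symm H e

  C-irr : Irreflexive _≡_ C
  C-irr {zero}  refl ()
  C-irr {suc _} refl e = irrefl H refl e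

P₅ : Graph 5
P₅ = path 5

gem : Graph 5
gem = cone (path 4)

_InducedSubgraphOf_ : Graph m → Graph n → Set
_InducedSubgraphOf_ {m} {n} H G =
  ∃ λ (f : Fin m → Fin n) →
    Injective _≡_ _≡_ f × (∀ i j → Adj H i j ⇔ Adj G (f i) (f j))

[P₅,gem]-Free : Graph n → Set
[P₅,gem]-Free G = ¬ (P₅ InducedSubgraphOf G) × ¬ (gem InducedSubgraphOf G)

-- The vertices other than v are renumbered by punchIn v, the order-preserving
-- bijection from Fin n onto Fin (suc n) without v.
_─_ : Graph n → Fin n → Graph (pred n)
_─_ {suc _} G v = record
  { Adj    = λ i j → Adj G (punchIn v i) (punchIn v j)
  ; adj?   = λ i j → adj? G (punchIn v i) (punchIn v j)
  ; symm   = symm G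
  ; irrefl = λ i≡j → irrefl G (cong (punchIn v) i≡j)
  }

Colourable : Graph n → ℕ → Set
Colourable {n} G k = ∃ λ (c : Fin n → Fin k) → ∀ u v → Adj G u v → c u ≢ c v

χ[_]≡_ : Graph n → ℕ → Set
χ[ G ]≡ k = Colourable G k × (∀ j → Colourable G j → k ≤ j)

χ[_]<_ : Graph n → ℕ → Set
χ[ G ]< k = ∃ λ j → χ[ G ]≡ j × j < k

VertexCritical : ℕ → Graph n → Set
VertexCritical k G = χ[ G ]≡ k × (∀ v → χ[ G ─ v ]< k)

Complete AntiComplete : Graph n → VSet n → VSet n → Set
Complete     G S T = ∀ s t → s ∈ S → t ∈ T → Adj G s t
AntiComplete G S T = ∀ s t → s ∈ S → t ∈ T → ¬ Adj G s t

IsModule : Graph n → VSet n → Set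
IsModule G S = ∀ v → v ∉ S → Complete G ｛ v ｝ S ⊎ AntiComplete G ｛ v ｝ S

-- For v ∈ S, the vertex set of the component of G[S] containing v: the vertices
-- joined to v by a walk all of whose vertices lie in S. (For v ∉ S it is {v}.)
Component : Graph n → VSet n → Fin n → VSet n
Component G S v u = Star (λ x y → x ∈ S × y ∈ S × Adj G x y) v u

record ℋ (G : Graph n) : Set where
  field
    free : [P₅,gem]-Free G
    -- The partition, given by the index of the part containing each vertex;
    -- the index # i stands for A_{i+1}.
    part : Fin n → Fin 7

  A : Fin 7 → VSet n
  A i v = part v ≡ i

  A₁ : VSet n
  A₁ = A (# 0)
  A₂ : VSet n
  A₂ = A (# 1)
  A₃ : VSet n
  A₃ = A (# 2)
  A₄ : VSet n
  A₄ = A (# 3)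
  A₅ : VSet n
  A₅ = A (# 4)
  A₆ : VSet n
  A₆ = A (# 5)
  A₇ : VSet n
  A₇ = A (# 6)

  field
    nonempty      : ∀ i → ∃ λ v → v ∈ A i
    complete₁     : Complete     G A₁ (A₂ ∪ A₅ ∪ A₆)
    antiComplete₁ : AntiComplete G A₁ (A₃ ∪ A₄ ∪ A₇)
    complete₂     : Complete     G A₂ (A₁ ∪ A₃)
    antiComplete₂ : AntiComplete G A₂ (A₄ ∪ A₅ ∪ A₆ ∪ A₇)
    complete₃     : Complete     G A₃ (A₂ ∪ A₄ ∪ A₆)
    antiComplete₃ : AntiComplete G A₃ (A₁ ∪ A₅ ∪ A₇)
    complete₄     : Complete     G A₄ (A₃ ∪ A₅ ∪ A₆)
    antiComplete₄ : AntiComplete G A₄ (A₁ ∪ A₂ ∪ A₇)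
    complete₅     : Complete     G A₅ (A₁ ∪ A₄)
    antiComplete₅ : AntiComplete G A₅ (A₂ ∪ A₃ ∪ A₆ ∪ A₇)
    modules₇      : ∀ v → v ∈ A₇ → IsModule G (Component G A₇ v)
    neighbour₇    : ∀ v → v ∈ A₇ → ∃ λ w → w ∈ A₆ × Adj G v w

{-# OPTIONS --safe #-}

-- Put p = k - 1. Deleting a vertex of A₂ gives a p-colouring φ of the rest, and
-- deleting one of A₆ gives a p-colouring ψ of the rest. In G - A₇ the sets
-- A₁, …, A₅ form a blown-up 5-cycle, and A₆ is joined to A₁, A₃, A₄ only. Let
-- φ use t colours on A₆, let each of A₁, A₃, A₄ be coloured with the fewer
-- colours, aᵢ, used there by φ and ψ, and let ψ use a₂, a₅ colours on A₂, A₅.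
-- Then ψ gives aᵢ + aᵢ₊₁ ≤ p around the cycle and Σ aᵢ ≤ 2p, and φ gives
-- a₁ + t ≤ p and a₃ + a₄ + t ≤ p. Under these inequalities φ on A₆ ∪ A₇ extends
-- to a p-colouring of G, with A₁, …, A₅ receiving (cyclic) intervals of colours.
module Submission where

open import Defs
open import Data.Fin using (Fin; zero; suc; _≟_; punchOut; inject≤; fromℕ<)
open import Data.Fin.Patterns
open import Data.Fin.Properties using (any?; all?; punchIn-punchOut; inject≤-injective; fromℕ<-injective)
open import Data.Fin.Subset using (Subset; inside; outside; _∈_; _∉_; _⊆_; _∩_; _∪_; ∁; ∣_∣; Empty)
open import Data.Fin.Subset.Properties
  using (_∈?_; ∣p∣≤n; ∣⊥∣≡0; Empty-unique; p⊆q⇒∣p∣≤∣q∣; ∣∁p∣≡n∸∣p∣; x∉p⇒x∈∁p;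
         x∈p∩q⁻; x∈p∪q⁻)
open import Data.List using (List; []; _∷_)
import Data.List.Membership.DecPropositional as DecMembership
open import Data.List.Relation.Unary.All using (All; []; _∷_; lookup)
open import Data.Nat using (ℕ; suc; _+_; _∸_; _≤_; _<_; _≥_; _<?_; z≤n; z<s; s≤s; s<s)
open import Data.Nat.Properties hiding (_≟_)
open import Data.Nat.Solver using (module +-*-Solver)
open import Data.Product using (∃; _×_; _,_; proj₁; proj₂)
open import Data.Product.Properties using (≡-dec)
open import Data.Sum using (_⊎_; inj₁; inj₂; [_,_]′)
open import Data.Vec using ([]; _∷_; here; there; tabulate)
open import Data.Vec.Properties using (lookup∘tabulate; lookup⇒[]=; []=⇒lookup)
open import Function using (_∘_; case_of_)
open import Relation.Binary.PropositionalEquality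
open import Relation.Nullary using (¬_; Dec; yes; no; does; contradiction)
open import Relation.Nullary.Decidable using (True; toWitness; from-yes; _⊎-dec_; _×-dec_; dec-true)

private
  variable
    n p : ℕ

-- Counting colours in disjoint sets.

Disjoint : Subset n → Subset n → Set
Disjoint S T = ∀ {x} → x ∈ S → x ∉ T

-- Inclusion-exclusion in additive form, so that no truncated subtraction enters the counting.
∣∪∣+∣∩∣ : (S T : Subset n) → ∣ S ∪ T ∣ + ∣ S ∩ T ∣ ≡ ∣ S ∣ + ∣ T ∣
∣∪∣+∣∩∣ []            []            = refl
∣∪∣+∣∩∣ (outside ∷ S) (outside ∷ T) = ∣∪∣+∣∩∣ S T
∣∪∣+∣∩∣ (inside  ∷ S) (outside ∷ T) = cong suc (∣∪∣+∣∩∣ S T)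
∣∪∣+∣∩∣ (outside ∷ S) (inside  ∷ T) =
  trans (cong suc (∣∪∣+∣∩∣ S T)) (sym (+-suc ∣ S ∣ ∣ T ∣))
∣∪∣+∣∩∣ (inside  ∷ S) (inside  ∷ T) = cong suc
  (trans (+-suc ∣ S ∪ T ∣ ∣ S ∩ T ∣)
    (trans (cong suc (∣∪∣+∣∩∣ S T)) (sym (+-suc ∣ S ∣ ∣ T ∣))))

∣disjoint-∪∣ : (S T : Subset n) → Disjoint S T → ∣ S ∣ + ∣ T ∣ ≡ ∣ S ∪ T ∣
∣disjoint-∪∣ {n} S T S#T = begin
  ∣ S ∣ + ∣ T ∣         ≡⟨ ∣∪∣+∣∩∣ S T ⟨
  ∣ S ∪ T ∣ + ∣ S ∩ T ∣ ≡⟨ cong (λ R → ∣ S ∪ T ∣ + ∣ R ∣) (Empty-unique empty) ⟩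
  ∣ S ∪ T ∣ + _         ≡⟨ cong (∣ S ∪ T ∣ +_) (∣⊥∣≡0 n) ⟩
  ∣ S ∪ T ∣ + 0         ≡⟨ +-identityʳ _ ⟩
  ∣ S ∪ T ∣             ∎
  where
  open ≡-Reasoning
  empty : Empty (S ∩ T)
  empty (x , x∈S∩T) = let x∈S , x∈T = x∈p∩q⁻ S T x∈S∩T in S#T x∈S x∈T

∣disjoint∣≤ : (S T : Subset n) → Disjoint S T → ∣ S ∣ + ∣ T ∣ ≤ n
∣disjoint∣≤ S T S#T = ≤-trans (≤-reflexive (∣disjoint-∪∣ S T S#T)) (∣p∣≤n (S ∪ T))

-- R ∪ T is disjoint from S, while R ∩ T is disjoint from the disjoint sets U, V.
∣5-cycle∣≤ : (R S T U V : Subset n) → Disjoint R S → Disjoint S T → Disjoint T U →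
             Disjoint U V → Disjoint R V →
             (∣ T ∣ + ∣ U ∣ + ∣ V ∣) + (∣ R ∣ + ∣ S ∣) ≤ n + n
∣5-cycle∣≤ {n} R S T U V R#S S#T T#U U#V R#V = begin
  (t + u + v) + (r + s)                       ≡⟨ solve 5 (λ r s t u v →
      (t :+ u :+ v) :+ (r :+ s) := (r :+ t) :+ (u :+ v) :+ s) refl r s t u v ⟩
  (r + t) + (u + v) + s                       ≡⟨ cong (λ x → x + (u + v) + s) (∣∪∣+∣∩∣ R T) ⟨
  (∣ R ∪ T ∣ + ∣ R ∩ T ∣) + (u + v) + s       ≡⟨ cong (λ x → (∣ R ∪ T ∣ + ∣ R ∩ T ∣) + x + s)
                                                      (∣disjoint-∪∣ U V U#V) ⟩
  (∣ R ∪ T ∣ + ∣ R ∩ T ∣) + ∣ U ∪ V ∣ + s     ≡⟨ solve 4 (λ a b c s →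
      (a :+ b) :+ c :+ s := (a :+ s) :+ (b :+ c)) refl (∣ R ∪ T ∣) (∣ R ∩ T ∣) (∣ U ∪ V ∣) s ⟩
  (∣ R ∪ T ∣ + s) + (∣ R ∩ T ∣ + ∣ U ∪ V ∣)   ≤⟨ +-mono-≤
      (∣disjoint∣≤ (R ∪ T) S RT#S) (∣disjoint∣≤ (R ∩ T) (U ∪ V) RT#UV) ⟩
  n + n                                       ∎
  where
  open ≤-Reasoning
  open +-*-Solver
  r = ∣ R ∣
  s = ∣ S ∣
  t = ∣ T ∣
  u = ∣ U ∣
  v = ∣ V ∣

  RT#S : Disjoint (R ∪ T) S
  RT#S x∈RT x∈S = case x∈p∪q⁻ R T x∈RT of λ where
    (inj₁ x∈R) → R#S x∈R x∈S
    (inj₂ x∈T) → S#T x∈S x∈T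

  RT#UV : Disjoint (R ∩ T) (U ∪ V)
  RT#UV x∈RT x∈UV with x∈p∩q⁻ R T x∈RT | x∈p∪q⁻ U V x∈UV
  ... | x∈R , x∈T | inj₁ x∈U = T#U x∈T x∈U
  ... | x∈R , x∈T | inj₂ x∈V = R#V x∈R x∈V

-- Injective renumberings of colours.

rank : Subset n → Fin n → ℕ
rank (_       ∷ S) zero    = 0
rank (inside  ∷ S) (suc x) = suc (rank S x)
rank (outside ∷ S) (suc x) = rank S x

rank< : (S : Subset n) {x : Fin n} → x ∈ S → rank S x < ∣ S ∣
rank< (inside  ∷ S) here        = z<s
rank< (inside  ∷ S) (there x∈S) = s<s (rank< S x∈S)
rank< (outside ∷ S) (there x∈S) = rank< S x∈S

rank-injective : (S : Subset n) {x y : Fin n} → x ∈ S → y ∈ S → rank S x ≡ rank S y → x ≡ y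
rank-injective (_       ∷ S) here        here        _  = refl
rank-injective (inside  ∷ S) (there x∈S) (there y∈S) eq =
  cong suc (rank-injective S x∈S y∈S (suc-injective eq))
rank-injective (outside ∷ S) (there x∈S) (there y∈S) eq =
  cong suc (rank-injective S x∈S y∈S eq)

∣∁∣+∣∣ : (S : Subset n) → ∣ ∁ S ∣ + ∣ S ∣ ≡ n
∣∁∣+∣∣ S = trans (cong (_+ ∣ S ∣) (∣∁p∣≡n∸∣p∣ S)) (m∸n+n≡m (∣p∣≤n S))

-- The renumbering of Fin n that lists the complement of S first and then S.
sendLast : Subset n → Fin n → ℕ
sendLast S x with x ∈? S
... | yes _ = ∣ ∁ S ∣ + rank S x
... | no  _ = rank (∁ S) x

sendLast< : (S : Subset n) (x : Fin n) → sendLast S x < n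
sendLast< S x with x ∈? S
... | yes x∈S = <-≤-trans (+-monoʳ-< ∣ ∁ S ∣ (rank< S x∈S)) (≤-reflexive (∣∁∣+∣∣ S))
... | no  x∉S = <-≤-trans (rank< (∁ S) (x∉p⇒x∈∁p x∉S)) (∣p∣≤n (∁ S))

sendLast≥ : (S : Subset n) (x : Fin n) → x ∈ S → ∣ ∁ S ∣ ≤ sendLast S x
sendLast≥ S x x∈S with x ∈? S
... | yes _   = m≤m+n _ _
... | no  x∉S = contradiction x∈S x∉S

sendLast-injective : (S : Subset n) {x y : Fin n} → sendLast S x ≡ sendLast S y → x ≡ y
sendLast-injective S {x} {y} eq with x ∈? S | y ∈? S
... | yes x∈S | yes y∈S = rank-injective S x∈S y∈S (+-cancelˡ-≡ ∣ ∁ S ∣ _ _ eq)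
... | no  x∉S | no  y∉S = rank-injective (∁ S) (x∉p⇒x∈∁p x∉S) (x∉p⇒x∈∁p y∉S) eq
... | yes x∈S | no  y∉S =
  contradiction (≤-trans (m≤m+n _ _) (≤-reflexive eq)) (<⇒≱ (rank< (∁ S) (x∉p⇒x∈∁p y∉S)))
... | no  x∉S | yes y∈S =
  contradiction (≤-trans (m≤m+n _ _) (≤-reflexive (sym eq))) (<⇒≱ (rank< (∁ S) (x∉p⇒x∈∁p x∉S)))

-- Turns an initial segment into a cyclic interval: the values from `s` up to `d + s`, the latter
-- excluded, are skipped. Numbers below `a₅` stay below `p` when `d = p ∸ a₅`.
insertGap : (s d : ℕ) → ℕ → ℕ
insertGap s d x with x <? s
... | yes _ = x
... | no  _ = d + x

insertGap-range : ∀ s d x → insertGap s d x < s ⊎ d + s ≤ insertGap s d x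
insertGap-range s d x with x <? s
... | yes x<s = inj₁ x<s
... | no  x≮s = inj₂ (+-monoʳ-≤ d (≮⇒≥ x≮s))

insertGap≤ : ∀ s d x → insertGap s d x ≤ d + x
insertGap≤ s d x with x <? s
... | yes _ = m≤n+m x d
... | no  _ = ≤-refl

insertGap-injective : ∀ s d {x y} → insertGap s d x ≡ insertGap s d y → x ≡ y
insertGap-injective s d {x} {y} eq with x <? s | y <? s
... | yes _   | yes _   = eq
... | no  _   | no  _   = +-cancelˡ-≡ d x y eq
... | yes x<s | no  y≮s =
  contradiction (≤-<-trans (m≤n+m y d) (subst (_< s) eq x<s)) y≮s
... | no  x≮s | yes y<s =
  contradiction (≤-<-trans (m≤n+m x d) (subst (_< s) (sym eq) y<s)) x≮s

-- Two hypotheses because `∸` truncates: if `m ≤ n`, the left side is just `o`; otherwise `n`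
-- cancels from the second hypothesis.
∸+≤ : ∀ m n {o q} → o ≤ q → m + o ≤ n + q → (m ∸ n) + o ≤ q
∸+≤ m n {o} {q} o≤q m+o≤n+q = begin
  (m ∸ n) + o ≤⟨ +-monoˡ-≤ o (m≤n+o⇒m∸n≤o m n m≤n+[q∸o]) ⟩
  (q ∸ o) + o ≡⟨ m∸n+n≡m o≤q ⟩
  q           ∎
  where
  open ≤-Reasoning
  m≤n+[q∸o] : m ≤ n + (q ∸ o)
  m≤n+[q∸o] = ≤-trans (m+n≤o⇒m≤o∸n m m+o≤n+q) (≤-reflexive (+-∸-assoc n o≤q))

-- Colourings of a vertex-deleted graph as maps on all vertices.

Proper≢ : Graph n → Fin n → (Fin n → Fin p) → Set
Proper≢ G v c = ∀ u w → v ≢ u → v ≢ w → Adj G u w → c u ≢ c w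

-- The colour given to v itself is junk: it is that of w.
undelete : ∀ {G : Graph n} {v w : Fin n} {j} → v ≢ w → j ≤ p → Colourable (G ─ v) j →
           ∃ λ (c : Fin n → Fin p) → Proper≢ G v c
undelete {suc n} {p} {G} {v} {w} v≢w j≤p (c , proper) = c′ , proper′
  where
  c′ : Fin (suc n) → Fin p
  c′ u with v ≟ u
  ... | yes _   = inject≤ (c (punchOut v≢w)) j≤p
  ... | no  v≢u = inject≤ (c (punchOut v≢u)) j≤p

  proper′ : Proper≢ G v c′
  proper′ u x v≢u v≢x u~x eq with v ≟ u | v ≟ x
  ... | yes v≡u | _       = v≢u v≡u
  ... | no  _   | yes v≡x = v≢x v≡x
  ... | no  v≢u | no  v≢x = proper (punchOut v≢u) (punchOut v≢x)
    (subst₂ (Adj G) (sym (punchIn-punchOut v≢u)) (sym (punchIn-punchOut v≢x)) u~x)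
    (inject≤-injective j≤p j≤p _ _ eq)

-- Adjacency between the seven parts.

edges nonEdges : List (Fin 7 × Fin 7)
edges = (0F , 1F) ∷ (0F , 4F) ∷ (0F , 5F) ∷ (1F , 2F) ∷ (2F , 3F) ∷ (2F , 5F) ∷ (3F , 4F) ∷
        (3F , 5F) ∷ []
nonEdges = (0F , 2F) ∷ (0F , 3F) ∷ (0F , 6F) ∷ (1F , 3F) ∷ (1F , 4F) ∷ (1F , 5F) ∷ (1F , 6F) ∷
           (2F , 4F) ∷ (2F , 6F) ∷ (3F , 6F) ∷ (4F , 5F) ∷ (4F , 6F) ∷ []

-- φ is kept on A₆ ∪ A₇, so these two parts need no disjoint palettes.
Kept : Fin 7 → Set
Kept i = i ≡ 5F ⊎ i ≡ 6F

kept? : ∀ i → Dec (Kept i)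
kept? i = (i ≟ 5F) ⊎-dec (i ≟ 6F)

open DecMembership (≡-dec {A = Fin 7} {B = λ _ → Fin 7} _≟_ _≟_) using () renaming (_∈_ to _∈ᴸ_; _∈?_ to _∈ᴸ?_)

abstract
  -- Each unordered pair of distinct parts is listed once, except `5F`, `6F`, which is prescribed
  -- neither complete nor anti-complete and falls under `Kept`. All 49 ordered pairs are checked by
  -- evaluation; `abstract` keeps the result from unfolding.
  classify : ∀ i j → i ≡ j ⊎ (Kept i × Kept j) ⊎ (i , j) ∈ᴸ edges ⊎ (j , i) ∈ᴸ edges ⊎
                     (i , j) ∈ᴸ nonEdges ⊎ (j , i) ∈ᴸ nonEdges
  classify = from-yes (all? λ i → all? λ j →
    (i ≟ j) ⊎-dec (kept? i ×-dec kept? j) ⊎-dec ((i , j) ∈ᴸ? edges) ⊎-dec ((j , i) ∈ᴸ? edges) ⊎-dec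
    ((i , j) ∈ᴸ? nonEdges) ⊎-dec ((j , i) ∈ᴸ? nonEdges))

module _ {n} {G : Graph n} (H : ℋ G) where
  open ℋ H

  joined : All (λ (i , j) → Complete G (A i) (A j)) edges
  joined = (λ u w p q → complete₁ u w p (inj₁ q))
         ∷ (λ u w p q → complete₁ u w p (inj₂ (inj₁ q)))
         ∷ (λ u w p q → complete₁ u w p (inj₂ (inj₂ q)))
         ∷ (λ u w p q → complete₂ u w p (inj₂ q))
         ∷ (λ u w p q → complete₃ u w p (inj₂ (inj₁ q)))
         ∷ (λ u w p q → complete₃ u w p (inj₂ (inj₂ q)))
         ∷ (λ u w p q → complete₄ u w p (inj₂ (inj₁ q)))
         ∷ (λ u w p q → complete₄ u w p (inj₂ (inj₂ q)))
         ∷ []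

  separated : All (λ (i , j) → AntiComplete G (A i) (A j)) nonEdges
  separated = (λ u w p q → antiComplete₁ u w p (inj₁ q))
            ∷ (λ u w p q → antiComplete₁ u w p (inj₂ (inj₁ q)))
            ∷ (λ u w p q → antiComplete₁ u w p (inj₂ (inj₂ q)))
            ∷ (λ u w p q → antiComplete₂ u w p (inj₁ q))
            ∷ (λ u w p q → antiComplete₂ u w p (inj₂ (inj₁ q)))
            ∷ (λ u w p q → antiComplete₂ u w p (inj₂ (inj₂ (inj₁ q))))
            ∷ (λ u w p q → antiComplete₂ u w p (inj₂ (inj₂ (inj₂ q))))
            ∷ (λ u w p q → antiComplete₃ u w p (inj₂ (inj₁ q)))
            ∷ (λ u w p q → antiComplete₃ u w p (inj₂ (inj₂ q)))
            ∷ (λ u w p q → antiComplete₄ u w p (inj₂ (inj₂ q)))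
            ∷ (λ u w p q → antiComplete₅ u w p (inj₂ (inj₂ (inj₁ q))))
            ∷ (λ u w p q → antiComplete₅ u w p (inj₂ (inj₂ (inj₂ q))))
            ∷ []

  -- Colours used on a single part.

  ColouringOf : Fin 7 → ℕ → Set
  ColouringOf i a = ∃ λ (f : Fin n → ℕ) →
    (∀ u → part u ≡ i → f u < a) ×
    (∀ u w → part u ≡ i → part w ≡ i → Adj G u w → f u ≢ f w)

  used? : ∀ (c : Fin n → Fin p) i x → Dec (∃ λ u → part u ≡ i × c u ≡ x)
  used? c i x = any? λ u → (part u ≟ i) ×-dec (c u ≟ x)

  colours : (Fin n → Fin p) → Fin 7 → Subset p
  colours c i = tabulate (does ∘ used? c i)

  ∈colours⁺ : ∀ (c : Fin n → Fin p) {i u} → part u ≡ i → c u ∈ colours c i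
  ∈colours⁺ c {i} {u} u∈Aᵢ = lookup⇒[]= (c u) _
    (trans (lookup∘tabulate _ (c u)) (dec-true (used? c i (c u)) (u , u∈Aᵢ , refl)))

  ∈colours⁻ : ∀ (c : Fin n → Fin p) {i x} → x ∈ colours c i → ∃ λ u → part u ≡ i × c u ≡ x
  ∈colours⁻ c {i} {x} x∈ with used? c i x | trans (sym (lookup∘tabulate (does ∘ used? c i) x)) ([]=⇒lookup x∈)
  ... | yes used | _ = used
  ... | no  _    | ()

  -- Although a single vertex is deleted, the whole of its part is left unconstrained: `φ` is never
  -- consulted on `A₂`, nor `ψ` on `A₆`.
  ProperOutside : Fin 7 → (Fin n → Fin p) → Set
  ProperOutside l c = ∀ u w → l ≢ part u → l ≢ part w → Adj G u w → c u ≢ c w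

  colours-disjoint : ∀ {l} {c : Fin n → Fin p} → ProperOutside l c → ∀ i j →
                     {True ((i , j) ∈ᴸ? edges)} → l ≢ i → l ≢ j →
                     Disjoint (colours c i) (colours c j)
  colours-disjoint {c = c} proper i j {e} l≢i l≢j x∈i x∈j
    with ∈colours⁻ c x∈i | ∈colours⁻ c x∈j
  ... | u , refl , cu≡x | w , refl , cw≡x =
    proper u w l≢i l≢j (lookup joined (toWitness e) u w refl refl) (trans cu≡x (sym cw≡x))

  -- Ranking within the set of used colours packs them into an initial segment of ℕ, which can then
  -- be moved by adding an offset.
  compress : ∀ {l} {c : Fin n → Fin p} → ProperOutside l c → ∀ i → l ≢ i →
             ColouringOf i ∣ colours c i ∣
  compress {c = c} proper i l≢i =
    rank (colours c i) ∘ c ,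
    (λ u u∈ → rank< (colours c i) (∈colours⁺ c u∈)) ,
    (λ { u w refl w∈ u~w eq → proper u w l≢i (λ l≡ → l≢i (trans l≡ w∈)) u~w
           (rank-injective (colours c i) (∈colours⁺ c refl) (∈colours⁺ c w∈) eq) })

  -- The smaller count inherits the upper bounds of both colourings: those from `φ` against `A₆` and
  -- those from `ψ` around the 5-cycle.
  fewer : ∀ {i a b} → ColouringOf i a → ColouringOf i b →
          ∃ λ m → ColouringOf i m × m ≤ a × m ≤ b
  fewer {_} {a} {b} f g with ≤-total a b
  ... | inj₁ a≤b = a , f , ≤-refl , a≤b
  ... | inj₂ b≤a = b , g , b≤a , ≤-refl

  -- Recolouring by cyclic intervals.

  module Recolour {p} {φ : Fin n → Fin p} (φ-proper : ProperOutside 1F φ)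
    {a₁ a₂ a₃ a₄ a₅ : ℕ}
    (F₁ : ColouringOf 0F a₁) (F₂ : ColouringOf 1F a₂) (F₃ : ColouringOf 2F a₃)
    (F₄ : ColouringOf 3F a₄) (F₅ : ColouringOf 4F a₅)
    (a₁₂ : a₁ + a₂ ≤ p) (a₂₃ : a₂ + a₃ ≤ p) (a₄₅ : a₄ + a₅ ≤ p) (a₁₅ : a₁ + a₅ ≤ p)
    (a₁₂₃₄₅ : (a₃ + a₄ + a₅) + (a₁ + a₂) ≤ p + p)
    (a₁₆ : a₁ ≤ ∣ ∁ (colours φ 5F) ∣) (a₃₄₆ : a₃ + a₄ ≤ ∣ ∁ (colours φ 5F) ∣) where

    open ≤-Reasoning

    T : Subset p
    T = colours φ 5F

    -- The least offset of the interval for A₁ that leaves room for A₅.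
    s : ℕ
    s = (a₃ + a₄ + a₅) ∸ p

    -- Keeps the wrapped piece of the interval for `A₅` inside that of `A₃`, where overlap is
    -- harmless, and so off that of `A₄`.
    s≤a₃ : s ≤ a₃
    s≤a₃ = m≤n+o⇒m∸n≤o (a₃ + a₄ + a₅) p (begin
      a₃ + a₄ + a₅   ≡⟨ +-assoc a₃ a₄ a₅ ⟩
      a₃ + (a₄ + a₅) ≤⟨ +-monoʳ-≤ a₃ a₄₅ ⟩
      a₃ + p         ≡⟨ +-comm a₃ p ⟩
      p + a₃         ∎)

    -- For `s = 0` this rests on `a₁₂`; for positive `s` it is the bound `a₁₂₃₄₅` on the whole
    -- cycle.
    s₁₂ : s + a₁ ≤ p ∸ a₂
    s₁₂ = m+n≤o⇒m≤o∸n (s + a₁) (begin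
      s + a₁ + a₂   ≡⟨ +-assoc s a₁ a₂ ⟩
      s + (a₁ + a₂) ≤⟨ ∸+≤ (a₃ + a₄ + a₅) p a₁₂ a₁₂₃₄₅ ⟩
      p             ∎)

    -- For `s = 0` this rests on `a₁₆`; for positive `s` on the sum of `a₃₄₆` and `a₁₅`.
    s₁₆ : s + a₁ ≤ ∣ ∁ T ∣
    s₁₆ = ∸+≤ (a₃ + a₄ + a₅) p a₁₆ (begin
      a₃ + a₄ + a₅ + a₁   ≡⟨ +-assoc (a₃ + a₄) a₅ a₁ ⟩
      a₃ + a₄ + (a₅ + a₁) ≤⟨ +-mono-≤ a₃₄₆ (≤-trans (≤-reflexive (+-comm a₅ a₁)) a₁₅) ⟩
      ∣ ∁ T ∣ + p         ≡⟨ +-comm ∣ ∁ T ∣ p ⟩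
      p + ∣ ∁ T ∣         ∎)

    a₂≤p : a₂ ≤ p
    a₂≤p = m+n≤o⇒n≤o a₁ a₁₂

    a₅≤p : a₅ ≤ p
    a₅≤p = m+n≤o⇒n≤o a₁ a₁₅

    -- The number of colours left free by `A₅`, hence the length of the gap in its interval; `A₁` is
    -- placed at the start of that gap.
    d : ℕ
    d = p ∸ a₅

    s₁₅ : s + a₁ ≤ d + s
    s₁₅ = begin
      s + a₁ ≤⟨ +-monoʳ-≤ s (m+n≤o⇒m≤o∸n a₁ a₁₅) ⟩
      s + d  ≡⟨ +-comm s d ⟩
      d + s  ∎

    -- The choice of `s` enters here: it makes `p + s` at least `a₃ + a₄ + a₅`, so the upper piece
    -- for `A₅` clears `A₄`.
    s₃₄₅ : a₃ + a₄ ≤ d + s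
    s₃₄₅ = +-cancelʳ-≤ a₅ (a₃ + a₄) (d + s) (begin
      a₃ + a₄ + a₅ ≤⟨ m≤n+m∸n (a₃ + a₄ + a₅) p ⟩
      p + s        ≡⟨ cong (_+ s) (m∸n+n≡m a₅≤p) ⟨
      d + a₅ + s   ≡⟨ +-assoc d a₅ s ⟩
      d + (a₅ + s) ≡⟨ cong (d +_) (+-comm a₅ s) ⟩
      d + (s + a₅) ≡⟨ +-assoc d s a₅ ⟨
      d + s + a₅   ∎)

    -- `A₃` and then `A₄` fill the bottom, `A₂` and `A₆` end at the top, `A₁` starts at `s`, and
    -- `A₅` cyclically ends just before `s`. `A₇` is unrestricted, since its outside neighbours all
    -- lie in `A₆`.
    Palette : Fin 7 → ℕ → Set
    Palette 0F x = s ≤ x × x < s + a₁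
    Palette 1F x = p ∸ a₂ ≤ x
    Palette 2F x = x < a₃
    Palette 3F x = a₃ ≤ x × x < a₃ + a₄
    Palette 4F x = x < s ⊎ d + s ≤ x
    Palette 5F x = ∣ ∁ T ∣ ≤ x
    Palette 6F x = 0 ≤ x

    palettes-disjoint : All (λ (i , j) → ∀ {x} → Palette i x → ¬ Palette j x) edges
    palettes-disjoint = (λ (_ , x<) ≤x → <⇒≱ (<-≤-trans x< s₁₂) ≤x)
      ∷ (λ { (s≤x , _) (inj₁ x<s) → <⇒≱ x<s s≤x
           ; (_ , x<)  (inj₂ ≤x)  → <⇒≱ (<-≤-trans x< s₁₅) ≤x })
      ∷ (λ (_ , x<) ≤x → <⇒≱ (<-≤-trans x< s₁₆) ≤x)
      ∷ (λ ≤x x< → <⇒≱ (<-≤-trans x< (m+n≤o⇒m≤o∸n a₃ (≤-trans (≤-reflexive (+-comm a₃ a₂)) a₂₃))) ≤x)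
      ∷ (λ x< (≤x , _) → <⇒≱ x< ≤x)
      ∷ (λ x< ≤x → <⇒≱ (<-≤-trans x< (≤-trans (m≤m+n a₃ a₄) a₃₄₆)) ≤x)
      ∷ (λ { (≤x , _) (inj₁ x<s) → <⇒≱ (<-≤-trans x<s s≤a₃) ≤x
           ; (_ , x<) (inj₂ ≤x)  → <⇒≱ (<-≤-trans x< s₃₄₅) ≤x })
      ∷ (λ (_ , x<) ≤x → <⇒≱ (<-≤-trans x< a₃₄₆) ≤x)
      ∷ []

    -- A single permutation of the colours is applied to `φ` on both `A₆` and `A₇`, so every edge
    -- inside their union stays properly coloured, while the colours of `A₆` move to the top.
    recolour : Fin 7 → Fin n → ℕ
    recolour 0F u = s + proj₁ F₁ u
    recolour 1F u = (p ∸ a₂) + proj₁ F₂ u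
    recolour 2F u = proj₁ F₃ u
    recolour 3F u = a₃ + proj₁ F₄ u
    recolour 4F u = insertGap s d (proj₁ F₅ u)
    recolour 5F u = sendLast T (φ u)
    recolour 6F u = sendLast T (φ u)

    ∈Palette : ∀ i u → part u ≡ i → Palette i (recolour i u)
    ∈Palette 0F u u∈ = m≤m+n s _ , +-monoʳ-< s (proj₁ (proj₂ F₁) u u∈)
    ∈Palette 1F u u∈ = m≤m+n _ _
    ∈Palette 2F u u∈ = proj₁ (proj₂ F₃) u u∈
    ∈Palette 3F u u∈ = m≤m+n a₃ _ , +-monoʳ-< a₃ (proj₁ (proj₂ F₄) u u∈)
    ∈Palette 4F u u∈ = insertGap-range s d _
    ∈Palette 5F u u∈ = sendLast≥ T (φ u) (∈colours⁺ φ u∈)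
    ∈Palette 6F u u∈ = z≤n

    recolour< : ∀ i u → part u ≡ i → recolour i u < p
    recolour< 0F u u∈ = <-≤-trans (proj₂ (∈Palette 0F u u∈)) (≤-trans s₁₂ (m∸n≤m p a₂))
    recolour< 1F u u∈ = <-≤-trans (+-monoʳ-< (p ∸ a₂) (proj₁ (proj₂ F₂) u u∈))
                                  (≤-reflexive (m∸n+n≡m a₂≤p))
    recolour< 2F u u∈ = <-≤-trans (∈Palette 2F u u∈) (m+n≤o⇒n≤o a₂ a₂₃)
    recolour< 3F u u∈ = <-≤-trans (proj₂ (∈Palette 3F u u∈)) (≤-trans a₃₄₆ (∣p∣≤n (∁ T)))
    recolour< 4F u u∈ = ≤-<-trans (insertGap≤ s d _)
                          (<-≤-trans (+-monoʳ-< d (proj₁ (proj₂ F₅) u u∈))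
                                     (≤-reflexive (m∸n+n≡m a₅≤p)))
    recolour< 5F u u∈ = sendLast< T (φ u)
    recolour< 6F u u∈ = sendLast< T (φ u)

    recolour-kept : ∀ {i u} → Kept i → recolour i u ≡ sendLast T (φ u)
    recolour-kept (inj₁ refl) = refl
    recolour-kept (inj₂ refl) = refl

    1≢kept : ∀ {i} → Kept i → 1F ≢ i
    1≢kept (inj₁ ()) refl
    1≢kept (inj₂ ()) refl

    φ-injective : ∀ {i j u w} → Kept i → Kept j → recolour i u ≡ recolour j w → φ u ≡ φ w
    φ-injective i-kept j-kept eq = sendLast-injective T
      (trans (sym (recolour-kept i-kept)) (trans eq (recolour-kept j-kept)))

    within-part : ∀ i {u w} → part u ≡ i → part w ≡ i → Adj G u w → recolour i u ≢ recolour i w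
    within-part 0F u∈ w∈ u~w eq = proj₂ (proj₂ F₁) _ _ u∈ w∈ u~w (+-cancelˡ-≡ s _ _ eq)
    within-part 1F u∈ w∈ u~w eq = proj₂ (proj₂ F₂) _ _ u∈ w∈ u~w (+-cancelˡ-≡ (p ∸ a₂) _ _ eq)
    within-part 2F u∈ w∈ u~w eq = proj₂ (proj₂ F₃) _ _ u∈ w∈ u~w eq
    within-part 3F u∈ w∈ u~w eq = proj₂ (proj₂ F₄) _ _ u∈ w∈ u~w (+-cancelˡ-≡ a₃ _ _ eq)
    within-part 4F u∈ w∈ u~w eq = proj₂ (proj₂ F₅) _ _ u∈ w∈ u~w (insertGap-injective s d eq)
    within-part 5F u∈ w∈ u~w eq = φ-proper _ _ (1≢kept (inj₁ u∈)) (1≢kept (inj₁ w∈)) u~w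
                                    (sendLast-injective T eq)
    within-part 6F u∈ w∈ u~w eq = φ-proper _ _ (1≢kept (inj₂ u∈)) (1≢kept (inj₂ w∈)) u~w
                                    (sendLast-injective T eq)

    recolour-proper : ∀ u w → Adj G u w → recolour (part u) u ≢ recolour (part w) w
    recolour-proper u w u~w eq with classify (part u) (part w)
    ... | inj₁ same =
      within-part (part u) refl (sym same) u~w
        (subst (λ i → recolour (part u) u ≡ recolour i w) (sym same) eq)
    ... | inj₂ (inj₁ (u-kept , w-kept)) =
      φ-proper u w (1≢kept u-kept) (1≢kept w-kept) u~w (φ-injective u-kept w-kept eq)
    ... | inj₂ (inj₂ (inj₁ e)) =
      lookup palettes-disjoint e (∈Palette _ u refl) (subst (Palette _) (sym eq) (∈Palette _ w refl))
    ... | inj₂ (inj₂ (inj₂ (inj₁ e))) =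
      lookup palettes-disjoint e (∈Palette _ w refl) (subst (Palette _) eq (∈Palette _ u refl))
    ... | inj₂ (inj₂ (inj₂ (inj₂ (inj₁ e)))) = lookup separated e u w refl refl u~w
    ... | inj₂ (inj₂ (inj₂ (inj₂ (inj₂ e)))) = lookup separated e w u refl refl (symm G u~w)

    recolourable : Colourable G p
    recolourable = (λ u → fromℕ< (recolour< (part u) u refl)) ,
      λ u w u~w eq → recolour-proper u w u~w (fromℕ<-injective _ _ _ _ eq)

  -- The inequalities, and the contradiction with criticality.

  colourable : ∀ {p} {φ ψ : Fin n → Fin p} → ProperOutside 1F φ → ProperOutside 5F ψ →
               Colourable G p
  colourable {p} {φ} {ψ} φ-proper ψ-proper
    with fewer (compress φ-proper 0F (λ ())) (compress ψ-proper 0F (λ ()))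
       | fewer (compress φ-proper 2F (λ ())) (compress ψ-proper 2F (λ ()))
       | fewer (compress φ-proper 3F (λ ())) (compress ψ-proper 3F (λ ()))
  ... | a₁ , F₁ , a₁≤φ , a₁≤ψ | a₃ , F₃ , a₃≤φ , a₃≤ψ | a₄ , F₄ , a₄≤φ , a₄≤ψ =
    Recolour.recolourable φ-proper
      F₁ (compress ψ-proper 1F (λ ())) F₃ F₄ (compress ψ-proper 4F (λ ()))
      -- The five bounds around the cycle come from `ψ`, which is proper on all of `A₁`, ..., `A₅`.
      (≤-trans (+-monoˡ-≤ _ a₁≤ψ) (∣disjoint∣≤ (Ψ 0F) (Ψ 1F) 01#))
      (≤-trans (+-monoʳ-≤ ∣ Ψ 1F ∣ a₃≤ψ) (∣disjoint∣≤ (Ψ 1F) (Ψ 2F) 12#))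
      (≤-trans (+-monoˡ-≤ _ a₄≤ψ) (∣disjoint∣≤ (Ψ 3F) (Ψ 4F) 34#))
      (≤-trans (+-monoˡ-≤ _ a₁≤ψ) (∣disjoint∣≤ (Ψ 0F) (Ψ 4F) 04#))
      (≤-trans (+-mono-≤ (+-monoˡ-≤ _ (+-mono-≤ a₃≤ψ a₄≤ψ)) (+-monoˡ-≤ _ a₁≤ψ))
               (∣5-cycle∣≤ (Ψ 0F) (Ψ 1F) (Ψ 2F) (Ψ 3F) (Ψ 4F) 01# 12# 23# 34# 04#))
      -- The two bounds against `A₆` come from `φ`. The colour sets of `A₃` and `A₄` are disjoint,
      -- so their sizes add up inside the complement of those of `A₆`.
      (≤-trans a₁≤φ (p⊆q⇒∣p∣≤∣q∣ (avoids-A₆ 0F (λ ()))))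
      (≤-trans (+-mono-≤ a₃≤φ a₄≤φ)
        (≤-trans (≤-reflexive (∣disjoint-∪∣ (Φ 2F) (Φ 3F)
                                (colours-disjoint φ-proper 2F 3F (λ ()) (λ ()))))
          (p⊆q⇒∣p∣≤∣q∣ ([ avoids-A₆ 2F (λ ()) , avoids-A₆ 3F (λ ()) ]′ ∘ x∈p∪q⁻ (Φ 2F) (Φ 3F)))))
    where
    Φ Ψ : Fin 7 → Subset p
    Φ = colours φ
    Ψ = colours ψ
    01# = colours-disjoint ψ-proper 0F 1F (λ ()) (λ ())
    12# = colours-disjoint ψ-proper 1F 2F (λ ()) (λ ())
    23# = colours-disjoint ψ-proper 2F 3F (λ ()) (λ ())
    34# = colours-disjoint ψ-proper 3F 4F (λ ()) (λ ())
    04# = colours-disjoint ψ-proper 0F 4F (λ ()) (λ ())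

    avoids-A₆ : ∀ i {e : True ((i , 5F) ∈ᴸ? edges)} → 1F ≢ i → Φ i ⊆ ∁ (Φ 5F)
    avoids-A₆ i {e} 1≢i x∈ = x∉p⇒x∈∁p (colours-disjoint φ-proper i 5F {e} 1≢i (λ ()) x∈)

theorem2p9 : ∀ {n : ℕ} (G : Graph n) → ℋ G → (k : ℕ) → k ≥ 1 → ¬ VertexCritical k G
theorem2p9 {n} G H (suc p) _ ((_ , minimal) , critical) =
  1+n≰n (minimal p (colourable H (proj₂ (colouringOutside 1F 5F λ ()))
                                 (proj₂ (colouringOutside 5F 1F λ ()))))
  where
  open ℋ H
  colouringOutside : ∀ l m → l ≢ m → ∃ λ (c : Fin n → Fin p) → ProperOutside H l c
  -- The part `m` only provides a vertex `w` distinct from the deleted `v`, whose colour serves as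
  -- the default at `v`.
  colouringOutside l m l≢m with nonempty l | nonempty m
  ... | v , refl | w , refl with critical v
  ... | j , (c , _) , s≤s j≤p with undelete {G = G} (l≢m ∘ cong part) j≤p c
  ... | c′ , proper = c′ , λ x y l≢x l≢y → proper x y (l≢x ∘ cong part) (l≢y ∘ cong part)
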